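{- Let $S$ be a finite completely simple semigroup of order $n$. Then the Cayley table of $S$ is an equi-$n$-square; that is, for every $s\in S$ there are exactly $n$ pairs $(a,b)\in S\times S$ with $ab=s$.
   Context: A semigroup $S$ is simple if it has no (nonempty, two-sided) ideals other than itself. A simple semigroup is completely simple if it contains a primitive idempotent, i.e. an idempotent $e$ such that for every idempotent $f$ of the semigroup, $ef=fe=f\neq 0$ implies $e=f$ (the condition $f\ne 0$ being relevant only if there is a zero element). An equi-$n$-square is an $n\times n$ array on $n$ symbols in which each symbol occurs exactly $n$ times in the whole array; the elements of $S$ serve as the $n$ symbols. -}

module Defs where

open import Level using (_⊔_; suc)
open import Algebra.Bundles using (Semigroup)
open import Algebra.Definitions using (_IdempotentOn_; Zero)
open import Data.Fin.Base using (Fin)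
open import Data.Nat.Base using (ℕ)
open import Data.Product.Base using (∃; _×_; _,_; proj₁)
open import Data.Product.Relation.Binary.Pointwise.NonDependent using (×-setoid)
open import Function.Bundles using (Func; Inverse)
open import Relation.Binary.Bundles using (Setoid)
open import Relation.Binary.Definitions using (_Respects_)
import Relation.Binary.Construct.On as On
open import Relation.Binary.PropositionalEquality.Properties using (setoid)
open import Relation.Nullary.Negation.Core using (¬_)
open import Relation.Unary using (Pred; _∈_; Satisfiable; Universal)

HasOrder : ∀ {a ℓ} → Setoid a ℓ → ℕ → Set (a ⊔ ℓ)
HasOrder A n = Inverse (setoid (Fin n)) A

module _ {c ℓ} (S : Semigroup c ℓ) where
  open Semigroup S using (Carrier; _≈_; _∙_)

  record IsIdeal {p} (I : Pred Carrier p) : Set (c ⊔ ℓ ⊔ p) where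
    field
      respects-≈ : I Respects _≈_
      nonempty   : Satisfiable I
      ∙-closedˡ  : ∀ s {x} → x ∈ I → s ∙ x ∈ I
      ∙-closedʳ  : ∀ s {x} → x ∈ I → x ∙ s ∈ I

  -- Subsets are predicates at level c ⊔ ℓ, where the principal ideals live.
  -- Each ideal, at any level, contains the principal ideal of any of its
  -- elements, so the choice of a (larger) level does not affect the notion.
  IsSimple : Set (suc (c ⊔ ℓ))
  IsSimple = (I : Pred Carrier (c ⊔ ℓ)) → IsIdeal I → Universal I

  -- The condition f ≠ 0 reads "f is not a zero element", since S need not
  -- have a zero.
  record IsPrimitiveIdempotent (e : Carrier) : Set (c ⊔ ℓ) where
    field
      idempotent : _IdempotentOn_ _≈_ _∙_ e
      minimal    : ∀ f → _IdempotentOn_ _≈_ _∙_ f → ¬ Zero _≈_ f _∙_ →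
                   e ∙ f ≈ f → f ∙ e ≈ f → e ≈ f

  record IsCompletelySimple : Set (suc (c ⊔ ℓ)) where
    field
      simple              : IsSimple
      primitiveIdempotent : ∃ IsPrimitiveIdempotent

Array : ∀ {i ℓi j ℓj a ℓa} → Setoid i ℓi → Setoid j ℓj → Setoid a ℓa →
        Set (i ⊔ ℓi ⊔ j ⊔ ℓj ⊔ a ⊔ ℓa)
Array I J A = Func (×-setoid I J) A

module _ {i ℓi j ℓj a ℓa}
         {I : Setoid i ℓi} {J : Setoid j ℓj} {A : Setoid a ℓa} where

  -- The cells containing the symbol s; two are equal when their positions are,
  -- whatever the proofs that they contain s.
  occurrences : Array I J A → Setoid.Carrier A → Setoid (i ⊔ j ⊔ ℓa) (ℓi ⊔ ℓj)
  occurrences M s = On.setoid (×-setoid I J) cell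
    where
    open Setoid A using (_≈_)

    cell : (∃ λ ij → Func.to M ij ≈ s) → Setoid.Carrier I × Setoid.Carrier J
    cell = proj₁

  record IsEquiSquare (n : ℕ) (M : Array I J A) :
         Set (i ⊔ ℓi ⊔ j ⊔ ℓj ⊔ a ⊔ ℓa) where
    field
      rows    : HasOrder I n
      columns : HasOrder J n
      symbols : HasOrder A n
      occurs  : ∀ s → HasOrder (occurrences M s) n

cayleyTable : ∀ {c ℓ} (S : Semigroup c ℓ) →
              let A = Semigroup.setoid S in Array A A A
cayleyTable S = record
  { to   = λ (a , b) → a ∙ b
  ; cong = λ (a≈a′ , b≈b′) → ∙-cong a≈a′ b≈b′
  }
  where open Semigroup S using (_∙_; ∙-cong)

{-# OPTIONS --safe #-}

-- In a finite simple semigroup a ≈ u(ab)v for some u, v, so a ≈ uⁱa(bv)ⁱ for all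
-- i; two powers of bv agree, which gives a ∈ abS, and dually b ∈ Sab. The second
-- fact makes translations cancellable: if y, y′ ∈ xS and py ≈ py′ then y ≈ y′.
-- Now fix s and relate x to the pairs (a , b) with a ≈ sx, ab ≈ s and
-- xS = bS. Such a pair exists for each x because s ∈ (sxx)S, such an x exists for
-- each pair with ab ≈ s because a ∈ sS and s ∈ sbS, and both are unique by
-- cancellation, so S is in bijection with the occurrences of s.
module Submission where

open import Defs
open import Algebra.Bundles using (Semigroup)
import Algebra.Construct.Flip.Op as Op
import Algebra.Properties.Semigroup as SemigroupProperties
import Algebra.Properties.Semigroup.Divisibility as SemigroupDivisibility
open import Data.Fin.Base using (toℕ)
open import Data.Fin.Properties using (pigeonhole)
open import Data.Nat.Base using (ℕ; zero; suc; _+_)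
open import Data.Nat.Properties using (n<1+n; m≤n⇒∃[o]m+o≡n)
open import Data.Product.Base using (∃; ∃₂; _×_; _,_; proj₁; proj₂)
open import Function.Base using (_∘_)
open import Function.Bundles using (Inverse)
import Function.Construct.Composition as Composition
open import Level using (_⊔_)
open import Relation.Binary.Bundles using (Setoid)
open import Relation.Binary.PropositionalEquality.Core as ≡ using ()
import Relation.Binary.Reasoning.Setoid as SetoidReasoning

module _ {c ℓ} (S : Semigroup c ℓ) where
  open Semigroup S
  open SemigroupProperties S using (x∙yz≈xy∙z)
  open SemigroupDivisibility S using (_∣ˡ_; _,_)
  open SetoidReasoning setoid

  AllFactorsOfAll : Set (c ⊔ ℓ)
  AllFactorsOfAll = ∀ x y → ∃₂ λ u v → y ≈ u ∙ (x ∙ v)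

  -- The set `SxS` is an ideal, so simplicity makes it all of `S`.
  simple⇒allFactorsOfAll : IsSimple S → AllFactorsOfAll
  simple⇒allFactorsOfAll simple x = simple (λ y → ∃₂ λ u v → y ≈ u ∙ (x ∙ v)) record
    { respects-≈ = λ y≈z (u , v , y≈uxv) → u , v , trans (sym y≈z) y≈uxv
    ; nonempty   = x ∙ (x ∙ x) , x , x , refl
    ; ∙-closedˡ  = λ s (u , v , y≈uxv) →
        s ∙ u , v , trans (∙-congˡ y≈uxv) (x∙yz≈xy∙z s u (x ∙ v))
    ; ∙-closedʳ  = λ s (u , v , y≈uxv) →
        u , v ∙ s ,
        trans (∙-congʳ y≈uxv) (trans (assoc u (x ∙ v) s) (∙-congˡ (assoc x v s)))
    }

  -- The exponent is shifted, power x k being xᵏ⁺¹, since S has no unit.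
  power : Carrier → ℕ → Carrier
  power x zero    = x
  power x (suc k) = x ∙ power x k

  power-+ : ∀ x i j → power x (suc (i + j)) ≈ power x i ∙ power x j
  power-+ x zero    j = refl
  power-+ x (suc i) j = trans (∙-congˡ (power-+ x i j)) (x∙yz≈xy∙z x (power x i) (power x j))

  power-sucʳ : ∀ x k → power x (suc k) ≈ power x k ∙ x
  power-sucʳ x zero    = refl
  power-sucʳ x (suc k) = trans (∙-congˡ (power-sucʳ x k)) (x∙yz≈xy∙z x (power x k) x)

  -- Substituting the equation for its own inner `a` wraps one more `u` and one more `w` around it.
  power-fixed : ∀ {a u w} → a ≈ u ∙ (a ∙ w) → ∀ k → a ≈ power u k ∙ (a ∙ power w k)
  power-fixed a≈uaw zero = a≈uaw
  power-fixed {a} {u} {w} a≈uaw (suc k) = begin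
    a                                       ≈⟨ power-fixed a≈uaw k ⟩
    power u k ∙ (a ∙ power w k)             ≈⟨ ∙-congˡ (∙-congʳ a≈uaw) ⟩
    power u k ∙ (u ∙ (a ∙ w) ∙ power w k)   ≈⟨ ∙-congˡ (assoc u (a ∙ w) (power w k)) ⟩
    power u k ∙ (u ∙ (a ∙ w ∙ power w k))   ≈⟨ x∙yz≈xy∙z (power u k) u _ ⟩
    power u k ∙ u ∙ (a ∙ w ∙ power w k)     ≈⟨ ∙-cong (sym (power-sucʳ u k)) (assoc a w (power w k)) ⟩
    power u (suc k) ∙ (a ∙ power w (suc k)) ∎

  power-factorˡ : ∀ x y k → ∃ λ t → power (x ∙ y) k ≈ x ∙ t
  power-factorˡ x y zero    = y , refl
  power-factorˡ x y (suc k) = y ∙ power (x ∙ y) k , assoc x y _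

  power-periodic : ∀ {n} → HasOrder setoid n → ∀ x →
                   ∃₂ λ i d → power x i ≈ power x i ∙ power x d
  power-periodic {n} order x
    with i , j , i<j , fi≡fj ← pigeonhole (n<1+n n) (Inverse.from order ∘ power x ∘ toℕ)
    -- Strictness of `i < j` is what leaves a genuine power as extra factor: with the shifted
    -- exponents, `j + 1` splits as `(i + 1) + (d + 1)`.
    with d , 1+i+d≡j ← m≤n⇒∃[o]m+o≡n i<j
    = toℕ i , d , (begin
        power x (toℕ i)                     ≈⟨ Inverse.strictlyInverseˡ order _ ⟨
        Inverse.to order (Inverse.from order (power x (toℕ i)))
                                            ≡⟨ ≡.cong (Inverse.to order) fi≡fj ⟩
        Inverse.to order (Inverse.from order (power x (toℕ j)))
                                            ≈⟨ Inverse.strictlyInverseˡ order _ ⟩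
        power x (toℕ j)                     ≡⟨ ≡.cong (power x) 1+i+d≡j ⟨
        power x (suc (toℕ i + d))           ≈⟨ power-+ x (toℕ i) d ⟩
        power x (toℕ i) ∙ power x d         ∎)

  -- For `w = b ∙ v`, the factor `wⁱ` at the right end of `a ≈ uⁱ ∙ (a ∙ wⁱ)` absorbs `wᵈ`, hence so
  -- does `a`; and `wᵈ` begins with `b`.
  finite⇒xy∣ˡx : ∀ {n} → HasOrder setoid n → AllFactorsOfAll →
                 ∀ a b → a ∙ b ∣ˡ a
  finite⇒xy∣ˡx order factors a b
    with u , v , a≈u[abv] ← factors (a ∙ b) a
    with i , d , wⁱ≈wⁱwᵈ ← power-periodic order (b ∙ v)
    with t , wᵈ≈bt ← power-factorˡ b v d
    = t , (begin
        a ∙ b ∙ t                         ≈⟨ assoc a b t ⟩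
        a ∙ (b ∙ t)                       ≈⟨ ∙-congˡ wᵈ≈bt ⟨
        a ∙ wᵈ                            ≈⟨ ∙-congʳ a≈uⁱawⁱ ⟩
        uⁱ ∙ (a ∙ wⁱ) ∙ wᵈ                ≈⟨ assoc uⁱ (a ∙ wⁱ) wᵈ ⟩
        uⁱ ∙ (a ∙ wⁱ ∙ wᵈ)                ≈⟨ ∙-congˡ (assoc a wⁱ wᵈ) ⟩
        uⁱ ∙ (a ∙ (wⁱ ∙ wᵈ))              ≈⟨ ∙-congˡ (∙-congˡ wⁱ≈wⁱwᵈ) ⟨
        uⁱ ∙ (a ∙ wⁱ)                     ≈⟨ a≈uⁱawⁱ ⟨
        a                                 ∎)
    where
    uⁱ = power u i
    wⁱ = power (b ∙ v) i
    wᵈ = power (b ∙ v) d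
    a≈uⁱawⁱ = power-fixed (trans a≈u[abv] (∙-congˡ (assoc a b v))) i

-- The condition is self-dual up to bracketing, so what follows from it also holds in mirror image.
allFactorsOfAll-op : ∀ {c ℓ} (S : Semigroup c ℓ) →
                     AllFactorsOfAll S → AllFactorsOfAll (Op.semigroup S)
allFactorsOfAll-op S factors x y with u , v , y≈u[xv] ← factors x y =
  v , u , trans y≈u[xv] (x∙yz≈xy∙z u x v)
  where
  open Semigroup S using (trans)
  open SemigroupProperties S using (x∙yz≈xy∙z)

module _ {c ℓ} (S : Semigroup c ℓ) where
  open Semigroup S
  open SemigroupDivisibility S using (_∣ˡ_; _∣ʳ_; _,_; x∣ˡxy; ∣ˡ-respˡ-≈)
  open SetoidReasoning setoid

  module _ (xy∣ˡx : ∀ x y → x ∙ y ∣ˡ x) (xy∣ʳy : ∀ x y → x ∙ y ∣ʳ y) where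

    -- If `y ≈ x ∙ t`, then `x` lies in `xtS = yS`. Thus `∣ˡ` is Green's relation R.
    ∣ˡ-sym : ∀ {x y} → x ∣ˡ y → y ∣ˡ x
    ∣ˡ-sym {x} (t , xt≈y) = ∣ˡ-respˡ-≈ xt≈y (xy∣ˡx x t)

    -- Some `r` has `r ∙ (p ∙ x) ≈ x`; left multiplication by `rp` then fixes all of `xS`, so it
    -- recovers `y` and `z` from `py` and `pz`.
    ∙-cancelˡ-∣ˡ : ∀ {x y z} p → x ∣ˡ y → x ∣ˡ z → p ∙ y ≈ p ∙ z → y ≈ z
    ∙-cancelˡ-∣ˡ {x} {y} {z} p (t , xt≈y) (t′ , xt′≈z) py≈pz
      with r , r[px]≈x ← xy∣ʳy p x
      = begin
          y             ≈⟨ rp-fixes t xt≈y ⟨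
          r ∙ (p ∙ y)   ≈⟨ ∙-congˡ py≈pz ⟩
          r ∙ (p ∙ z)   ≈⟨ rp-fixes t′ xt′≈z ⟩
          z             ∎
      where
      rp-fixes : ∀ {w} q → x ∙ q ≈ w → r ∙ (p ∙ w) ≈ w
      rp-fixes {w} q xq≈w = begin
        r ∙ (p ∙ w)         ≈⟨ ∙-congˡ (∙-congˡ xq≈w) ⟨
        r ∙ (p ∙ (x ∙ q))   ≈⟨ ∙-congˡ (assoc p x q) ⟨
        r ∙ (p ∙ x ∙ q)     ≈⟨ assoc r (p ∙ x) q ⟨
        r ∙ (p ∙ x) ∙ q     ≈⟨ ∙-congʳ r[px]≈x ⟩
        x ∙ q               ≈⟨ xq≈w ⟩
        w                   ∎

    module _ (s : Carrier) where

      Occurrence = ∃ λ ((a , b) : Carrier × Carrier) → a ∙ b ≈ s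

      -- b ∣ˡ x amounts to xS = bS since ∣ˡ is symmetric.
      Corresponds : Carrier → Occurrence → Set (c ⊔ ℓ)
      Corresponds x ((a , b) , _) = s ∙ x ≈ a × b ∣ˡ x

      occurrence : ∀ x → ∃ (Corresponds x)
      occurrence x with t₁ , sxt₁≈s ← xy∣ˡx s x
                   with t₂ , sxxt₂≈sx ← xy∣ˡx (s ∙ x) x
        -- The second entry must start with `x`: `t₂` undoes this `x` after `sx`, and `t₁` then
        -- takes `sx` back to `s`.
        = ((s ∙ x , x ∙ (t₂ ∙ t₁)) , sx∙xt≈s) , refl , xy∣ˡx x (t₂ ∙ t₁)
        where
        sx∙xt≈s = begin
          s ∙ x ∙ (x ∙ (t₂ ∙ t₁))   ≈⟨ assoc (s ∙ x) x (t₂ ∙ t₁) ⟨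
          s ∙ x ∙ x ∙ (t₂ ∙ t₁)     ≈⟨ assoc (s ∙ x ∙ x) t₂ t₁ ⟨
          s ∙ x ∙ x ∙ t₂ ∙ t₁       ≈⟨ ∙-congʳ sxxt₂≈sx ⟩
          s ∙ x ∙ t₁                ≈⟨ sxt₁≈s ⟩
          s                         ∎

      element : ∀ o → ∃ λ x → Corresponds x o
      element ((a , b) , ab≈s) with t , abt≈a ← xy∣ˡx a b
                               with r , sbr≈s ← xy∣ˡx s b
        -- The witness must start with `b`: `r` undoes this `b` after `s`, and `t` then takes
        -- `s ≈ ab` to `a`.
        = b ∙ (r ∙ t) , s∙brt≈a , x∣ˡxy b (r ∙ t)
        where
        s∙brt≈a = begin
          s ∙ (b ∙ (r ∙ t))   ≈⟨ assoc s b (r ∙ t) ⟨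
          s ∙ b ∙ (r ∙ t)     ≈⟨ assoc (s ∙ b) r t ⟨
          s ∙ b ∙ r ∙ t       ≈⟨ ∙-congʳ sbr≈s ⟩
          s ∙ t               ≈⟨ ∙-congʳ ab≈s ⟨
          a ∙ b ∙ t           ≈⟨ abt≈a ⟩
          a                   ∎

      -- The first entry is forced to be `sx`; the second entries both lie in `xS`, where `a`
      -- cancels.
      occurrence-unique : ∀ {x x′} (p : ∃ (Corresponds x)) (p′ : ∃ (Corresponds x′)) →
                          x ≈ x′ →
                          Setoid._≈_ (occurrences (cayleyTable S) s) (proj₁ p) (proj₁ p′)
      occurrence-unique (((a , b) , ab≈s) , sx≈a , b∣x)
                        (((a′ , b′) , a′b′≈s) , sx′≈a′ , b′∣x′) x≈x′ =
        a≈a′ ,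
        ∙-cancelˡ-∣ˡ a (∣ˡ-sym b∣x) (∣ˡ-respˡ-≈ (sym x≈x′) (∣ˡ-sym b′∣x′))
                     (trans ab≈s (trans (sym a′b′≈s) (∙-congʳ (sym a≈a′))))
        where
        a≈a′ = trans (sym sx≈a) (trans (∙-congˡ x≈x′) sx′≈a′)

      -- Both elements lie in `bS`, where `s` cancels.
      element-unique : ∀ {x x′} o o′ → Corresponds x o → Corresponds x′ o′ →
                       Setoid._≈_ (occurrences (cayleyTable S) s) o o′ → x ≈ x′
      element-unique _ _ (sx≈a , b∣x) (sx′≈a′ , b′∣x′) (a≈a′ , b≈b′) =
        ∙-cancelˡ-∣ˡ s b∣x (∣ˡ-respˡ-≈ (sym b≈b′) b′∣x′)
                     (trans sx≈a (trans a≈a′ (sym sx′≈a′)))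

      elements↔occurrences : Inverse setoid (occurrences (cayleyTable S) s)
      elements↔occurrences = record
        { to        = proj₁ ∘ occurrence
        ; from      = proj₁ ∘ element
        ; to-cong   = occurrence-unique (occurrence _) (occurrence _)
        ; from-cong = λ {o} {o′} →
            element-unique o o′ (proj₂ (element o)) (proj₂ (element o′))
        -- Each inverse law is uniqueness again, comparing the chosen partner with the given one.
        ; inverse   =
            (λ {o} → occurrence-unique (occurrence _) (o , proj₂ (element o))) ,
            (λ {x} {o} → element-unique o (proj₁ (occurrence x))
                           (proj₂ (element o)) (proj₂ (occurrence x)))
        }

theorem1p4 : ∀ {c ℓ} (S : Semigroup c ℓ) (n : ℕ) →
    HasOrder (Semigroup.setoid S) n →
    IsCompletelySimple S →
    IsEquiSquare n (cayleyTable S)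
theorem1p4 S n order completelySimple = record
  { rows    = order
  ; columns = order
  ; symbols = order
  ; occurs  = λ s →
      Composition.inverse order (elements↔occurrences S xy∣ˡx xy∣ʳy s)
  }
  where
  open Semigroup S using (_∙_)
  open SemigroupDivisibility S using (_∣ˡ_; _∣ʳ_; _,_)

  factors : AllFactorsOfAll S
  factors = simple⇒allFactorsOfAll S (IsCompletelySimple.simple completelySimple)

  xy∣ˡx : ∀ x y → x ∙ y ∣ˡ x
  xy∣ˡx = finite⇒xy∣ˡx S order factors

  xy∣ʳy : ∀ x y → x ∙ y ∣ʳ y
  xy∣ʳy x y with t , t[xy]≈y ←
    -- The arguments are swapped because `y` times `x` in the opposite semigroup is `x ∙ y`.
    finite⇒xy∣ˡx (Op.semigroup S) order (allFactorsOfAll-op S factors) y x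
    = t , t[xy]≈y
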